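{- (1) If $L\subseteq A^*$ is accepted by a nondeterministic finite automaton having depth $m$, then ${\downarrow}L$ and ${\downarrow}_<L$ are $\ell$-PT for $\ell=2m+2$. (2) The same holds if $L$ is accepted by a context-free grammar in quadratic normal form with $N$ nonterminals, with $\ell=4\cdot 3^{N-1}+2$.
   Context: The depth of an automaton is the maximum length of a simple (non-repeating) path from an initial state to some final state. A context-free grammar is in quadratic normal form if every production has one of the forms $X\to YZ$, $X\to Y$, $X\to a$ or $X\to\epsilon$, where $X,Y,Z$ are nonterminals and $a$ is a terminal letter. $u\sqsubseteq v$ (subword) means $u=a_1\cdots a_n$ with letters $a_i$ and $v=v_0a_1v_1\cdots a_nv_n$; $u\sqsubset v$ means $u\sqsubseteq v$ and $u\ne v$. ${\downarrow}L=\{v~|~\exists u\in L: v\sqsubseteq u\}$, ${\downarrow}_<L=\{v~|~\exists u\in L: v\sqsubset u\}$. $u\sim_n v$ iff $u,v$ have the same subwords of length at most $n$; $L$ is $n$-PT if it is a union of $\sim_n$-classes. -}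

module Defs where

open import Data.Fin.Base using (Fin)
open import Data.Fin.Subset using (Subset) renaming (_∈_ to _∈ₛ_)
open import Data.List.Base using (List; []; _∷_; _++_; length; map)
open import Data.List.Membership.Propositional using (_∈_)
open import Data.List.Relation.Binary.Sublist.Propositional using (_⊆_; _⊂_)
open import Data.List.Relation.Unary.All using (All)
open import Data.List.Relation.Unary.Unique.Propositional using (Unique)
open import Data.Nat.Base using (ℕ; _≤_)
open import Data.Product.Base using (∃-syntax; Σ-syntax; _×_; _,_; proj₂)
open import Data.Sum.Base using (_⊎_)
open import Function.Bundles using (_⇔_)
open import Level using (0ℓ)
open import Relation.Binary.Construct.Closure.ReflexiveTransitive using (Star)
open import Relation.Binary.PropositionalEquality.Core using (_≡_)
open import Relation.Unary using (Pred; _≐_; Empty)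

Word : ℕ → Set
Word k = List (Fin k)

Language : ℕ → Set₁
Language k = Pred (Word k) 0ℓ

-- The subword order ⊑ is the library's sublist order _⊆_.

↓_ : ∀ {k} → Language k → Language k
(↓ L) v = ∃[ u ] (L u × v ⊆ u)

↓<_ : ∀ {k} → Language k → Language k
(↓< L) v = ∃[ u ] (L u × v ⊂ u)

infix 8 ↓_ ↓<_

_∼[_]_ : ∀ {k} → Word k → ℕ → Word k → Set
u ∼[ n ] v = ∀ x → length x ≤ n → (x ⊆ u ⇔ x ⊆ v)

-- L is the union of the classes of the words in C.
PT : ∀ {k} → ℕ → Language k → Set₁
PT {k} n L = Σ[ C ∈ Language k ] (L ≐ λ w → ∃[ u ] (C u × u ∼[ n ] w))

record NFA (k n : ℕ) : Set where
  field
    initial : Subset n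
    final   : Subset n
    step    : Fin n → Fin k → Subset n

module _ {k n : ℕ} (M : NFA k n) where
  open NFA M

  data Path : Fin n → Word k → Fin n → Set where
    []   : ∀ {q} → Path q [] q
    _∷_  : ∀ {p q r a w} → q ∈ₛ step p a → Path q w r → Path p (a ∷ w) r

  states : ∀ {p w q} → Path p w q → List (Fin n)
  states {p} []      = p ∷ []
  states {p} (_ ∷ π) = p ∷ states π

  acceptedByNFA : Language k
  acceptedByNFA w = ∃[ p ] ∃[ q ] (p ∈ₛ initial × q ∈ₛ final × Path p w q)

  -- The length of a path is its number of transitions, i.e. the length of
  -- the word it reads.
  SimplePathLength : Pred ℕ 0ℓ
  SimplePathLength l = ∃[ p ] ∃[ q ] ∃[ w ] (p ∈ₛ initial × q ∈ₛ final ×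
    (∃[ π ] Unique (states {p} {w} {q} π)) × length w ≡ l)

  -- The maximum of the empty set, which arises when nothing is accepted, is 0.
  HasDepth : ℕ → Set
  HasDepth m = (∀ l → SimplePathLength l → l ≤ m) ×
    (SimplePathLength m ⊎ (Empty SimplePathLength × m ≡ 0))

data Symbol (k N : ℕ) : Set where
  nonterminal : Fin N → Symbol k N
  terminal    : Fin k → Symbol k N

-- The start symbol forces N ≥ 1.
record CFG (k N : ℕ) : Set where
  field
    start       : Fin N
    productions : List (Fin N × List (Symbol k N))

module _ {k N : ℕ} (G : CFG k N) where
  open CFG G

  data _⇒_ : List (Symbol k N) → List (Symbol k N) → Set where
    step : ∀ α β {X γ} → (X , γ) ∈ productions →
           (α ++ nonterminal X ∷ β) ⇒ (α ++ γ ++ β)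

  acceptedByCFG : Language k
  acceptedByCFG w = Star _⇒_ (nonterminal start ∷ []) (map terminal w)

data QuadraticRHS {k N : ℕ} : List (Symbol k N) → Set where
  pair   : ∀ Y Z → QuadraticRHS (nonterminal Y ∷ nonterminal Z ∷ [])
  unit   : ∀ Y → QuadraticRHS (nonterminal Y ∷ [])
  letter : ∀ a → QuadraticRHS (terminal a ∷ [])
  empty  : QuadraticRHS []

QuadraticNormalForm : ∀ {k N} → CFG k N → Set
QuadraticNormalForm G = All (λ r → QuadraticRHS (proj₂ r)) (CFG.productions G)

{-# OPTIONS --safe #-}

-- If every z ∈ L lies in a product E of t atoms (a + ε) or B* with E ⊆ ↓L, then
-- ↓L and ↓<L are (t + 1)-PT: reading w greedily, a word outside E has a subword of
-- length ≤ t + 1 outside E, so u ∈ E and u ∼ w give w ∈ E.  For ↓<L, either some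
-- star of E is nonempty and every word of E is a proper subword of another one, or
-- the words of E have length ≤ t and then u ∼ w gives w ⊑ u.
--
-- NFA: erasing loops turns an accepting path into a simple path with a loop at each
-- state; each loop contributes a star and each of the ≤ m transitions one letter.
--
-- CFG: if the root nonterminal X of a parse tree of z has two incomparable
-- occurrences, then B* ⊆ ↓L(X) for the letters B of z.  Otherwise the occurrences
-- form a chain, z = αvβ where X ⇒* αXβ and X does not occur strictly below the last
-- occurrence, which yields v; so z ∈ A* E B* with A, B the letters of α, β and E
-- obtained from the subtrees of that occurrence, which avoid X.
module Submission where

open import Defs
open import Data.Fin.Base as Fin using (Fin)
open import Data.Fin.Properties using (_≟_; pigeonhole)
open import Data.Fin.Subset using () renaming (_∈_ to _∈ₛ_)
open import Data.List.Base using (List; []; _∷_; _++_; [_]; length; map; lookup)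
open import Data.List.Membership.DecPropositional using (_∈?_)
open import Data.List.Membership.Propositional using (_∈_; _∉_)
open import Data.List.Membership.Propositional.Properties using (∈-lookup)
open import Data.List.Properties using (++-assoc; ++-identityʳ; length-map; length-++; map-++)
open import Data.List.Relation.Binary.Pointwise.Properties using (Pointwise-length)
open import Data.List.Relation.Binary.Sublist.Heterogeneous.Properties
  using (length-mono-≤; toPointwise)
open import Data.List.Relation.Binary.Sublist.Propositional
  using (_⊆_; _⊂_; []; _∷_; _∷ʳ_; ⊆-refl; ⊆-trans; ⊆-reflexive; from∈; minimum)
open import Data.List.Relation.Binary.Sublist.Propositional.Properties
  using (++⁺; ++⁺ˡ; ++⁺ʳ)
open import Data.List.Relation.Unary.All as All using (All; []; _∷_)
open import Data.List.Relation.Unary.All.Properties using (¬Any⇒All¬)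
open import Data.List.Relation.Unary.AllPairs using ([]; _∷_)
open import Data.List.Relation.Unary.Any using (here; there)
open import Data.List.Relation.Unary.Unique.Propositional using (Unique)
open import Data.Nat.Base using (ℕ; zero; suc; _+_; _*_; _^_; _∸_; _≤_; _<_; z≤n; s≤s)
open import Data.Nat.Properties hiding (_≟_)
open import Data.Nat.Tactic.RingSolver using (solve-∀)
open import Data.Product.Base using (∃-syntax; Σ-syntax; _×_; _,_)
open import Data.Sum.Base using (_⊎_; inj₁; inj₂)
open import Function.Base using (_∘_; id)
open import Function.Bundles using (module Equivalence; mk⇔)
open import Relation.Binary.Construct.Closure.ReflexiveTransitive using (Star; ε; _◅_; _◅◅_)
open import Relation.Binary.PropositionalEquality
  using (_≡_; _≢_; refl; sym; trans; cong; subst; subst₂)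
open import Relation.Nullary using (¬_; yes; no; contradiction)
open import Relation.Unary using (_≐_)

open Equivalence using (to; from)

private variable
  k ℓ ℓ′ n : ℕ
  u v w : Word k

-- Proper subwords and invariance under the subword equivalence

⊂⇒< : u ⊂ v → length u < length v
⊂⇒< (u⊆v , u≉v) = ≤∧≢⇒< (length-mono-≤ u⊆v) λ eq → u≉v (toPointwise eq u⊆v)

<⇒⊂ : u ⊆ v → length u < length v → u ⊂ v
<⇒⊂ u⊆v u<v = u⊆v , λ u≋v → <⇒≢ u<v (Pointwise-length u≋v)

∼-invariant⇒PT : {K : Language k} → (∀ {u w} → u ∼[ ℓ ] w → K u → K w) → PT ℓ K
∼-invariant⇒PT {K = K} inv =
  K , (λ {w} Kw → w , Kw , λ _ _ → mk⇔ id id) , λ (_ , Ku , u∼w) → inv u∼w Ku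

-- Products of atoms

data Atom (k : ℕ) : Set where
  opt  : Fin k → Atom k
  star : List (Fin k) → Atom k

private variable
  a b c : Fin k
  B : List (Fin k)
  x : Atom k
  E F : List (Atom k)

-- `skip` serves both as the empty choice of an `opt` and as the exit from a `star`.
data ⟦_⟧ {k} : List (Atom k) → Language k where
  []   : ⟦ [] ⟧ []
  skip : ⟦ E ⟧ w → ⟦ x ∷ E ⟧ w
  take : ⟦ E ⟧ w → ⟦ opt a ∷ E ⟧ (a ∷ w)
  loop : c ∈ B → ⟦ star B ∷ E ⟧ w → ⟦ star B ∷ E ⟧ (c ∷ w)

⟦⟧-⊆ : v ⊆ w → ⟦ E ⟧ w → ⟦ E ⟧ v
⟦⟧-⊆ []          []         = []
⟦⟧-⊆ s           (skip m)   = skip (⟦⟧-⊆ s m)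
⟦⟧-⊆ (_ ∷ʳ s)    (take m)   = skip (⟦⟧-⊆ s m)
⟦⟧-⊆ (refl ∷ s)  (take m)   = take (⟦⟧-⊆ s m)
⟦⟧-⊆ (_ ∷ʳ s)    (loop i m) = ⟦⟧-⊆ s m
⟦⟧-⊆ (refl ∷ s)  (loop i m) = loop i (⟦⟧-⊆ s m)

[]∈⟦⟧ : (E : List (Atom k)) → ⟦ E ⟧ []
[]∈⟦⟧ []      = []
[]∈⟦⟧ (_ ∷ E) = skip ([]∈⟦⟧ E)

⟦⟧-++⁺ : ⟦ E ⟧ u → ⟦ F ⟧ v → ⟦ E ++ F ⟧ (u ++ v)
⟦⟧-++⁺ []         m = m
⟦⟧-++⁺ (skip l)   m = skip (⟦⟧-++⁺ l m)
⟦⟧-++⁺ (take l)   m = take (⟦⟧-++⁺ l m)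
⟦⟧-++⁺ (loop i l) m = loop i (⟦⟧-++⁺ l m)

⟦⟧-++⁻ : (E : List (Atom k)) → ⟦ E ++ F ⟧ w →
         ∃[ u ] ∃[ v ] (w ≡ u ++ v × ⟦ E ⟧ u × ⟦ F ⟧ v)
⟦⟧-++⁻ []      m        = [] , _ , refl , [] , m
⟦⟧-++⁻ (_ ∷ E) (skip m) with u , v , eq , l , r ← ⟦⟧-++⁻ E m = u , v , eq , skip l , r
⟦⟧-++⁻ (_ ∷ E) (take m) with u , v , eq , l , r ← ⟦⟧-++⁻ E m =
  _ ∷ u , v , cong (_ ∷_) eq , take l , r
⟦⟧-++⁻ (y ∷ E) (loop i m) with u , v , eq , l , r ← ⟦⟧-++⁻ (y ∷ E) m =
  _ ∷ u , v , cong (_ ∷_) eq , loop i l , r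

⟦star⟧⁺ : All (_∈ B) u → ⟦ E ⟧ w → ⟦ star B ∷ E ⟧ (u ++ w)
⟦star⟧⁺ []       m = skip m
⟦star⟧⁺ (i ∷ is) m = loop i (⟦star⟧⁺ is m)

⟦star⟧⁻ : (K : Language k) → (∀ {c w} → c ∈ B → K w → K (c ∷ w)) →
          (∀ {w} → ⟦ E ⟧ w → K w) → ⟦ star B ∷ E ⟧ w → K w
⟦star⟧⁻ K close base (skip m)   = base m
⟦star⟧⁻ K close base (loop i m) = close i (⟦star⟧⁻ K close base m)

∈-self : (w : Word k) → All (_∈ w) w
∈-self w = All.tabulate id

⟦star⟧-self : (w : Word k) → ⟦ [ star w ] ⟧ w
⟦star⟧-self w = subst ⟦ _ ⟧ (++-identityʳ w) (⟦star⟧⁺ (∈-self w) [])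

⟦opts⟧⁺ : (w : Word k) → ⟦ map opt w ⟧ w
⟦opts⟧⁺ []      = []
⟦opts⟧⁺ (_ ∷ w) = take (⟦opts⟧⁺ w)

⟦opts⟧⁻ : (u : Word k) → ⟦ map opt u ⟧ w → w ⊆ u
⟦opts⟧⁻ []      []       = []
⟦opts⟧⁻ (a ∷ u) (skip m) = a ∷ʳ ⟦opts⟧⁻ u m
⟦opts⟧⁻ (a ∷ u) (take m) = refl ∷ ⟦opts⟧⁻ u m

-- Short subwords witnessing non-membership

Excluded : List (Atom k) → Language k
Excluded E w = ∃[ v ] (v ⊆ w × length v ≤ suc (length E) × ¬ ⟦ E ⟧ v)

-- A witness against `E` that begins with the blocked letter `b` also works against `x ∷ E`. Any
-- other witness first gets `b` in front, and the additional atom pays for this letter.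
Excluded-∷ : (∀ {v} → ⟦ x ∷ E ⟧ (b ∷ v) → ⟦ E ⟧ (b ∷ v)) →
             Excluded E (b ∷ w) → Excluded (x ∷ E) (b ∷ w)
Excluded-∷ blocked (_ , refl ∷ s , le , v∉) = _ , refl ∷ s , m≤n⇒m≤1+n le , v∉ ∘ blocked
Excluded-∷ blocked (_ , b ∷ʳ s , le , v∉)   =
  _ , refl ∷ s , s≤s le , v∉ ∘ ⟦⟧-⊆ (b ∷ʳ ⊆-refl) ∘ blocked

-- Greedy reading loses nothing because products are closed under subwords: if the rest of the word
-- fails after a letter is consumed, skipping the atom instead cannot help.
exclude : ∀ E (w : Word k) → ⟦ E ⟧ w ⊎ Excluded E w
exclude []            []      = inj₁ []
exclude []            (b ∷ w) = inj₂ ([ b ] , refl ∷ minimum w , s≤s z≤n , λ ())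
exclude (x ∷ E)       []      = inj₁ ([]∈⟦⟧ (x ∷ E))
exclude (opt a ∷ E)   (b ∷ w) with b ≟ a | exclude E w | exclude E (b ∷ w)
... | yes refl | inj₁ m                 | _      = inj₁ (take m)
... | yes refl | inj₂ (v , s , le , v∉) | _      = inj₂
  (b ∷ v , refl ∷ s , s≤s le , λ { (skip m) → v∉ (⟦⟧-⊆ (b ∷ʳ ⊆-refl) m) ; (take m) → v∉ m })
... | no _     | _                      | inj₁ m = inj₁ (skip m)
... | no b≢a   | _                      | inj₂ e =
  inj₂ (Excluded-∷ (λ { (skip m) → m ; (take m) → contradiction refl b≢a }) e)
exclude (star B ∷ E)  (b ∷ w) with _∈?_ _≟_ b B | exclude (star B ∷ E) w | exclude E (b ∷ w)
... | yes b∈B | inj₁ m                 | _      = inj₁ (loop b∈B m)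
-- The star stays in place, so the witness for the rest of the word is against the same product and
-- needs no new letter.
... | yes _   | inj₂ (v , s , le , v∉) | _      = inj₂ (v , b ∷ʳ s , le , v∉)
... | no _    | _                      | inj₁ m = inj₁ (skip m)
... | no b∉B  | _                      | inj₂ e =
  inj₂ (Excluded-∷ (λ { (skip m) → m ; (loop i _) → contradiction i b∉B }) e)

⟦⟧-∼ : length E < ℓ → u ∼[ ℓ ] w → ⟦ E ⟧ u → ⟦ E ⟧ w
⟦⟧-∼ {E = E} {w = w} E<ℓ u∼w u∈E with exclude E w
... | inj₁ w∈E               = w∈E
... | inj₂ (v , s , le , v∉) =
  contradiction (⟦⟧-⊆ (from (u∼w v (≤-trans le E<ℓ)) s) u∈E) v∉

-- The subwords of `u` form the product of its letters taken as optional atoms.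
∼⇒⊇ : length u < ℓ → u ∼[ ℓ ] w → w ⊆ u
∼⇒⊇ {u = u} u<ℓ u∼w =
  ⟦opts⟧⁻ u (⟦⟧-∼ (subst (_< _) (sym (length-map opt u)) u<ℓ) u∼w (⟦opts⟧⁺ u))

-- Without a nonempty star, each atom reads at most one letter; a nonempty star can always read one
-- letter more. The case `star []` reads nothing and so counts as bounded.
bounded⊎extensible : (E : List (Atom k)) →
  (∀ {w} → ⟦ E ⟧ w → length w ≤ length E) ⊎
  (∀ {w} → ⟦ E ⟧ w → ∃[ v ] (⟦ E ⟧ v × w ⊆ v × length w < length v))
bounded⊎extensible []                 = inj₁ λ { [] → z≤n }
bounded⊎extensible (opt a ∷ E) with bounded⊎extensible E
... | inj₁ h = inj₁ λ { (skip m) → m≤n⇒m≤1+n (h m) ; (take m) → s≤s (h m) }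
... | inj₂ h = inj₂ λ
  { (skip m) → let v , m′ , s , lt = h m in v , skip m′ , s , lt
  ; (take m) → let v , m′ , s , lt = h m in a ∷ v , take m′ , refl ∷ s , s≤s lt }
bounded⊎extensible (star [] ∷ E) with bounded⊎extensible E
... | inj₁ h = inj₁ λ { (skip m) → m≤n⇒m≤1+n (h m) }
... | inj₂ h = inj₂ λ { (skip m) → let v , m′ , s , lt = h m in v , skip m′ , s , lt }
bounded⊎extensible (star (b ∷ B) ∷ E) =
  inj₂ λ {w} m → b ∷ w , loop (here refl) m , b ∷ʳ ⊆-refl , ≤-refl

-- Ideals and piecewise testability

-- `short` is strict because a witness of exclusion may have one letter more than there are atoms.
record Ideal (ℓ : ℕ) (L : Language k) (z : Word k) : Set where
  constructor ideal
  field
    atoms  : List (Atom k)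
    short  : length atoms < ℓ
    member : ⟦ atoms ⟧ z
    sound  : ∀ {w} → ⟦ atoms ⟧ w → (↓ L) w

Ideal-mono : ∀ {L L′ : Language k} {z} → ℓ ≤ ℓ′ → (∀ {w} → L w → L′ w) →
             Ideal ℓ L z → Ideal ℓ′ L′ z
Ideal-mono le f (ideal E lt m s) =
  ideal E (≤-trans lt le) m λ m → let z , Lz , w⊆z = s m in z , f Lz , w⊆z

ideals⇒PT : {L : Language k} → (∀ {z} → L z → Ideal ℓ L z) → PT ℓ (↓ L) × PT ℓ (↓< L)
ideals⇒PT {ℓ = ℓ} {L} ideals = ∼-invariant⇒PT invariant , ∼-invariant⇒PT invariant<
  where
  invariant : ∀ {u w} → u ∼[ ℓ ] w → (↓ L) u → (↓ L) w
  invariant u∼w (z , Lz , u⊆z) with ideal E E<ℓ z∈E sound ← ideals Lz =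
    sound (⟦⟧-∼ E<ℓ u∼w (⟦⟧-⊆ u⊆z z∈E))

  invariant< : ∀ {u w} → u ∼[ ℓ ] w → (↓< L) u → (↓< L) w
  invariant< u∼w (z , Lz , u⊂z@(u⊆z , _))
    with ideal E E<ℓ z∈E sound ← ideals Lz
    with bounded⊎extensible E
  -- Here `u` is shorter than `z`, which has at most `length E` letters, so `∼⇒⊇` applies to `u`.
  ... | inj₁ h = z , Lz , <⇒⊂ (⊆-trans w⊆u u⊆z) (≤-<-trans (length-mono-≤ w⊆u) u<z)
    where
    u<z = ⊂⇒< u⊂z
    w⊆u = ∼⇒⊇ (<-trans (<-≤-trans u<z (h z∈E)) E<ℓ) u∼w
  ... | inj₂ h =
    let v , v∈E , w⊆v , w<v = h (⟦⟧-∼ E<ℓ u∼w (⟦⟧-⊆ u⊆z z∈E))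
        y , Ly , v⊆y = sound v∈E
    in y , Ly , <⇒⊂ (⊆-trans w⊆v v⊆y) (<-≤-trans w<v (length-mono-≤ v⊆y))

↓-close : {L : Language k} → (∀ {z} → L z → L (u ++ z)) →
          ∀ {c w} → c ∈ u → (↓ L) w → (↓ L) (c ∷ w)
↓-close f c∈u (z , Lz , w⊆z) = _ , f Lz , ++⁺ (from∈ c∈u) w⊆z

-- Automata

module _ {k n : ℕ} (M : NFA k n) where
  open NFA M using () renaming (step to δ)

  private variable
    p q r : Fin n

  _++ₚ_ : Path M p u q → Path M q v r → Path M p (u ++ v) r
  []      ++ₚ ρ = ρ
  (e ∷ π) ++ₚ ρ = e ∷ (π ++ₚ ρ)

  -- A path with an arbitrary closed path set apart at each state; what remains is the spine.
  data Looped (p : Fin n) : Word k → Fin n → Set where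
    stop : Path M p v p → Looped p v p
    move : Path M p u p → q ∈ₛ δ p a → Looped q v r → w ≡ u ++ a ∷ v → Looped p w r

  spineWord : Looped p w r → Word k
  spineWord (stop _)             = []
  spineWord (move {a = a} _ _ d _) = a ∷ spineWord d

  spine : (d : Looped p w r) → Path M p (spineWord d) r
  spine (stop _)       = []
  spine (move _ e d _) = e ∷ spine d

  SimplyLooped : Fin n → Word k → Fin n → Set
  SimplyLooped p w r = Σ[ d ∈ Looped p w r ] Unique (states M (spine d))

  addLoop : Path M p u p → SimplyLooped p v r → SimplyLooped p (u ++ v) r
  addLoop         π (stop ρ          , uniq) = stop (π ++ₚ ρ) , uniq
  addLoop {u = u} π (move ρ e d refl , uniq) =
    move (π ++ₚ ρ) e d (sym (++-assoc u _ _)) , uniq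

  -- The part before the spine reaches `q` is flattened to an ordinary path, loops included; the
  -- part from `q` on keeps its decomposition.
  cut : (d : Looped p w r) → Unique (states M (spine d)) → q ∈ states M (spine d) →
        ∃[ u ] ∃[ v ] (w ≡ u ++ v × Path M p u q × SimplyLooped q v r)
  cut d@(stop _)       uniq       (here refl) = [] , _ , refl , [] , d , uniq
  cut d@(move _ _ _ _) uniq       (here refl) = [] , _ , refl , [] , d , uniq
  cut (move {u = t} π e d refl) (_ ∷ uniq) (there i)
    with u , v , refl , ρ , s ← cut d uniq i =
    t ++ _ ∷ u , v , sym (++-assoc t _ v) , π ++ₚ (e ∷ ρ) , s

  eraseLoops : Path M p w r → SimplyLooped p w r
  eraseLoops [] = stop [] , [] ∷ []
  eraseLoops {p = p} (e ∷ π)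
    with d , uniq ← eraseLoops π
    with _∈?_ _≟_ p (states M (spine d))
  ... | no p∉ = move [] e d refl , ¬Any⇒All¬ _ p∉ ∷ uniq
  -- The new transition leads back to `p`, so everything up to the visit of `p` on the spine joins
  -- the loop there.
  ... | yes i with u , v , refl , ρ , s ← cut d uniq i = addLoop (e ∷ ρ) s

  product : Looped p w r → List (Atom k)
  product (stop {v = v} _)               = star v ∷ []
  product (move {u = u} {a = a} _ _ d _) = star u ∷ opt a ∷ product d

  length-product : (d : Looped p w r) → length (product d) ≡ suc (2 * length (spineWord d))
  length-product (stop _)       = refl
  length-product (move _ _ d _) =
    cong suc (trans (cong suc (length-product d)) (sym (*-suc 2 (length (spineWord d)))))

  product-complete : (d : Looped p w r) → ⟦ product d ⟧ w
  product-complete (stop {v = v} _) = ⟦star⟧-self v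
  product-complete (move {u = u} _ _ d refl) = ⟦star⟧⁺ (∈-self u) (take (product-complete d))

  product-sound : (d : Looped p w r) → ⟦ product d ⟧ v → (↓ λ z → Path M p z r) v
  product-sound (stop π) =
    ⟦star⟧⁻ (↓ _) (↓-close (π ++ₚ_)) λ { [] → [] , [] , [] }
  product-sound (move π e d _) = ⟦star⟧⁻ (↓ _) (↓-close (π ++ₚ_)) λ
    -- Skipping the optional letter still takes the transition; its letter is only dropped from the
    -- subword.
    { (skip m) → let z , ρ , s = product-sound d m in _ , e ∷ ρ , _ ∷ʳ s
    ; (take m) → let z , ρ , s = product-sound d m in _ , e ∷ ρ , refl ∷ s }

  NFA-ideal : ∀ {m z} → HasDepth M m → acceptedByNFA M z → Ideal (2 * m + 2) (acceptedByNFA M) z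
  NFA-ideal {m} (bound , _) (p , q , p∈I , q∈F , π) with d , uniq ← eraseLoops π =
    ideal (product d) short (product-complete d) λ v∈ →
      let z , ρ , s = product-sound d v∈ in z , (p , q , p∈I , q∈F , ρ) , s
    where
    short : length (product d) < 2 * m + 2
    short = begin
      suc (length (product d))               ≡⟨ cong suc (length-product d) ⟩
      2 + 2 * length (spineWord d)           ≤⟨ +-monoʳ-≤ 2 (*-monoʳ-≤ 2 (bound _
        (p , q , spineWord d , p∈I , q∈F , (spine d , uniq) , refl))) ⟩
      2 + 2 * m                              ≡⟨ +-comm 2 (2 * m) ⟩
      2 * m + 2                              ∎
      where open ≤-Reasoning

-- Grammars

lookup-≢ : ∀ {xs : List (Fin n)} {i j} → Unique xs → i Fin.< j → lookup xs i ≢ lookup xs j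
lookup-≢ {i = Fin.zero}  {Fin.suc j} (x≢ ∷ _) _         = All.lookup x≢ (∈-lookup j)
lookup-≢ {i = Fin.suc i} {Fin.suc j} (_ ∷ u)  (s≤s i<j) = lookup-≢ u i<j

Unique⇒length≤ : {xs : List (Fin n)} → Unique xs → length xs ≤ n
Unique⇒length≤ {xs = xs} u = ≮⇒≥ λ n<l →
  let _ , _ , i<j , eq = pigeonhole n<l (lookup xs) in lookup-≢ u i<j eq

-- A bound for trees over n nonterminals; there are none for n = 0.
treeBound : ℕ → ℕ
treeBound zero    = 0
treeBound (suc n) = 4 * 3 ^ n

-- Accounts for two subtrees, 2 for the node itself and 2 for the stars on either side. Equality
-- holds at `n = 0`.
treeBound-suc : ∀ n → treeBound n + treeBound n + 4 ≤ treeBound (suc n)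
treeBound-suc zero    = ≤-refl
treeBound-suc (suc n) = begin
  4 * 3 ^ n + 4 * 3 ^ n + 4          ≤⟨ +-monoʳ-≤ (4 * 3 ^ n + 4 * 3 ^ n)
                                          (*-monoʳ-≤ 4 (m^n>0 3 n)) ⟩
  4 * 3 ^ n + 4 * 3 ^ n + 4 * 3 ^ n  ≡⟨ triple (3 ^ n) ⟩
  4 * (3 * 3 ^ n)                    ∎
  where
  open ≤-Reasoning
  triple : ∀ p → 4 * p + 4 * p + 4 * p ≡ 4 * (3 * p)
  triple = solve-∀

module _ {k N : ℕ} (G : CFG k N) where
  open CFG G

  private variable
    X Y Z : Fin N
    U : List (Fin N)
    T : Fin N → Language k

  -- The family `T` of subtrees is a parameter so that a root labelled `X` can have subtrees that
  -- avoid `X`.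
  data Node (T : Fin N → Language k) (X : Fin N) : Language k where
    pair   : (X , nonterminal Y ∷ nonterminal Z ∷ []) ∈ productions →
             T Y u → T Z v → Node T X (u ++ v)
    unit   : (X , nonterminal Y ∷ []) ∈ productions → T Y u → Node T X u
    letter : (X , terminal a ∷ []) ∈ productions → Node T X [ a ]
    empty  : (X , []) ∈ productions → Node T X []

  -- `U` lists the forbidden nonterminals.
  data Tree (U : List (Fin N)) (X : Fin N) (w : Word k) : Set where
    node : X ∉ U → Node (Tree U) X w → Tree U X w

  Derived : Fin N → Language k
  Derived = Tree []

  node′ : Node Derived X w → Derived X w
  node′ = node λ ()

  forget : Tree U X w → Derived X w
  forget (node _ (pair p t s)) = node′ (pair p (forget t) (forget s))
  forget (node _ (unit p t))   = node′ (unit p (forget t))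
  forget (node _ (letter p))   = node′ (letter p)
  forget (node _ (empty p))    = node′ (empty p)

  -- X does not occur below Y, its occurrences form a chain whose last element
  -- yields v, or two of them are incomparable.
  data Occurrences (U : List (Fin N)) (X : Fin N) (T : Fin N → Language k)
                   (Y : Fin N) (w : Word k) : Set where
    none     : T Y w → Occurrences U X T Y w
    chain    : ∀ α β → Node (Tree (X ∷ U)) X v → w ≡ α ++ v ++ β →
               (∀ {x} → Derived X x → Derived Y (α ++ x ++ β)) → Occurrences U X T Y w
    branched : (∀ {x y} → Derived X x → Derived X y → (↓ Derived Y) (x ++ y)) →
               Occurrences U X T Y w

  ⊆-infix : ∀ (α β : Word k) {x} → x ⊆ α ++ x ++ β
  ⊆-infix α β = ++⁺ˡ α (++⁺ʳ β ⊆-refl)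

  ++-infixʳ : ∀ (α x β v : Word k) → (α ++ x ++ β) ++ v ≡ α ++ x ++ (β ++ v)
  ++-infixʳ α x β v = trans (++-assoc α (x ++ β) v) (cong (α ++_) (++-assoc x β v))

  mutual
    occurrences : ∀ X → Tree U Y w → Occurrences U X (Tree (X ∷ U)) Y w
    occurrences {Y = Y} X (node Y∉U t) with occurrencesNode X t | Y ≟ X
    ... | chain α β b eq f | _        = chain α β b eq f
    ... | branched f       | _        = branched f
    -- A root labelled `X` starts the chain, with empty context, only when no `X` occurs below it.
    ... | none t′          | yes refl =
      chain [] [] t′ (sym (++-identityʳ _)) (subst (Derived _) (sym (++-identityʳ _)))
    ... | none t′          | no Y≢X   =
      none (node (λ { (here eq) → Y≢X eq ; (there i) → Y∉U i }) t′)

    occurrencesNode : ∀ X → Node (Tree U) Y w → Occurrences U X (Node (Tree (X ∷ U))) Y w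
    occurrencesNode X (pair {u = u} {v = v} p t s) with occurrences X t | occurrences X s
    ... | none t′ | none s′ = none (pair p t′ s′)
    ... | none _ | chain α β b refl f = chain (u ++ α) β b (sym (++-assoc u α _))
      λ {x} d → subst (Derived _) (sym (++-assoc u α (x ++ β))) (node′ (pair p (forget t) (f d)))
    ... | chain α β b refl f | none _ = chain α (β ++ v) b (++-infixʳ α _ β v)
      λ {x} d → subst (Derived _) (++-infixʳ α x β v) (node′ (pair p (f d) (forget s)))
    -- Occurrences in both subtrees are incomparable and can be replaced independently.
    ... | chain α β b _ f | chain α′ β′ b′ _ f′ = branched λ d e →
      _ , node′ (pair p (f d) (f′ e)) , ++⁺ (⊆-infix α β) (⊆-infix α′ β′)
    ... | branched f | _ = branched λ d e →
      let z , t′ , sub = f d e in z ++ v , node′ (pair p t′ (forget s)) , ++⁺ʳ v sub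
    ... | _ | branched f = branched λ d e →
      let z , s′ , sub = f d e in u ++ z , node′ (pair p (forget t) s′) , ++⁺ˡ u sub
    occurrencesNode X (unit p t) with occurrences X t
    ... | none t′          = none (unit p t′)
    ... | chain α β b eq f = chain α β b eq λ d → node′ (unit p (f d))
    ... | branched f       = branched λ d e →
      let z , t′ , sub = f d e in z , node′ (unit p t′) , sub
    occurrencesNode X (letter p) = none (letter p)
    occurrencesNode X (empty p)  = none (empty p)

  -- The context around `X` can be iterated, and each round supplies one letter of `α` on the left
  -- or of `β` on the right.
  pump-ideal : ∀ α β → (∀ {x} → Derived X x → Derived X (α ++ x ++ β)) →
               Ideal ℓ (Derived X) v → Ideal (2 + ℓ) (Derived X) (α ++ v ++ β)
  pump-ideal {X = X} {ℓ} α β pump (ideal E short member sound) =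
    ideal (star α ∷ E ++ [ star β ]) short′
      (⟦star⟧⁺ (∈-self α) (⟦⟧-++⁺ member (⟦star⟧-self β)))
      (⟦star⟧⁻ (↓ Derived X) pumpˡ λ m → let _ , _ , eq , l , r = ⟦⟧-++⁻ E m
                            in subst (↓ Derived X) (sym eq) (pumpsʳ r (sound l)))
    where
    short′ : suc (length (E ++ [ star β ])) < 2 + ℓ
    short′ = s≤s (subst (_≤ suc ℓ)
      (sym (trans (cong suc (length-++ E)) (cong suc (+-comm (length E) 1)))) (s≤s short))

    pumpˡ : c ∈ α → (↓ Derived X) w → (↓ Derived X) (c ∷ w)
    pumpˡ c∈α (z , d , sub) = _ , pump d , ++⁺ (from∈ c∈α) (++⁺ʳ β sub)

    -- Rounds are added on the outside, so the first letter of the star belongs to the innermost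
    -- one; hence `u` grows during the induction.
    pumpsʳ : ⟦ [ star β ] ⟧ w → (↓ Derived X) u → (↓ Derived X) (u ++ w)
    pumpsʳ (skip []) Du = subst (↓ Derived X) (sym (++-identityʳ _)) Du
    pumpsʳ {u = u} (loop {w = w} i m) (z , d , sub) =
      subst (↓ Derived X) (++-assoc u _ w)
        (pumpsʳ m (_ , pump d , ++⁺ˡ α (++⁺ sub (from∈ i))))

  mutual
    treeIdeal : ∀ n → Unique U → length U + n ≡ N → Tree U X w →
                Ideal (treeBound n) (Derived X) w
    -- `X` together with `U` would be more than `N` distinct nonterminals.
    treeIdeal {U = U} zero uniq eq (node X∉U _) =
      contradiction (Unique⇒length≤ (¬Any⇒All¬ U X∉U ∷ uniq))
        (<⇒≱ (s≤s (≤-reflexive (trans (sym eq) (+-identityʳ _)))))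
    treeIdeal {U = U} {X = X} {w = w} (suc n) uniq eq t@(node X∉U _) with occurrences X t
    ... | none (node X∉ _) = contradiction (here refl) X∉
    ... | chain α β b refl f = Ideal-mono chain-bound id
      (pump-ideal α β f (nodeIdeal n (¬Any⇒All¬ U X∉U ∷ uniq) (trans (sym (+-suc _ n)) eq) b))
      where
      chain-bound : 2 + (treeBound n + treeBound n + 2) ≤ treeBound (suc n)
      chain-bound = ≤-trans (≤-reflexive (two+two (treeBound n + treeBound n))) (treeBound-suc n)
        where
        two+two : ∀ a → 2 + (a + 2) ≡ a + 4
        two+two = solve-∀
    -- One occurrence of `X` receives the tree of `w`, which supplies the next letter; the other
    -- receives the tree built so far.
    ... | branched f = ideal [ star w ]
      (≤-trans (s≤s (s≤s z≤n)) (m+n≤o⇒n≤o (treeBound n + treeBound n) (treeBound-suc n)))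
      (⟦star⟧-self w)
      (⟦star⟧⁻ (↓ Derived X) (λ c∈w (z , d , sub) →
                   let y , d′ , sub′ = f (forget t) d
                   in y , d′ , ⊆-trans (++⁺ (from∈ c∈w) sub) sub′)
                λ { [] → w , forget t , minimum w })

    nodeIdeal : ∀ n → Unique U → length U + n ≡ N → Node (Tree U) X w →
                Ideal (treeBound n + treeBound n + 2) (Derived X) w
    nodeIdeal n uniq eq (pair p t s)
      with ideal E E< m sound ← treeIdeal n uniq eq t
         | ideal F F< m′ sound′ ← treeIdeal n uniq eq s =
      ideal (E ++ F) short (⟦⟧-++⁺ m m′) λ l →
        let _ , _ , eq , l₁ , l₂ = ⟦⟧-++⁻ E l
            _ , d , s₁ = sound l₁
            _ , e , s₂ = sound′ l₂
        in _ , node′ (pair p d e) , ⊆-trans (⊆-reflexive eq) (++⁺ s₁ s₂)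
      where
      short : length (E ++ F) < treeBound n + treeBound n + 2
      short = ≤-trans (s≤s (≤-trans (≤-reflexive (length-++ E)) (+-mono-≤ (<⇒≤ E<) (<⇒≤ F<))))
        (m<m+n (treeBound n + treeBound n) (s≤s z≤n))
    nodeIdeal n uniq eq (unit p t) = Ideal-mono
      (≤-trans (m≤m+n (treeBound n) (treeBound n)) (m≤m+n _ 2))
      (λ d → node′ (unit p d)) (treeIdeal n uniq eq t)
    -- For `n = 0` only the summand 2 leaves room for this atom.
    nodeIdeal n uniq eq (letter {a = a} p) = ideal [ opt a ] (m≤n+m 2 _) (take [])
      λ { (skip []) → [ a ] , node′ (letter p) , minimum _
        ; (take []) → [ a ] , node′ (letter p) , ⊆-refl }
    nodeIdeal n uniq eq (empty p) = ideal [] (≤-trans (s≤s z≤n) (m≤n+m 2 _)) []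
      λ { [] → [] , node′ (empty p) , [] }

  -- Parse trees and derivations

  -- The surrounding context lets the second subtree of a pair be expanded after the first has
  -- become terminal.
  Derived⇒Star : Derived X w → ∀ α β →
    Star (_⇒_ G) (α ++ nonterminal X ∷ β) (α ++ map terminal w ++ β)
  Derived⇒Star (node _ (pair {u = u} {v = v} p t s)) α β =
    step α β p ◅ Derived⇒Star t α _ ◅◅
      subst₂ (Star (_⇒_ G)) (++-assoc α _ _) eq (Derived⇒Star s (α ++ map terminal u) β)
    where
    eq : (α ++ map terminal u) ++ map terminal v ++ β ≡ α ++ map terminal (u ++ v) ++ β
    eq = trans (++-assoc α _ _) (cong (α ++_)
      (trans (sym (++-assoc (map terminal u) _ β)) (cong (_++ β) (sym (map-++ terminal u v)))))
  Derived⇒Star (node _ (unit p t)) α β = step α β p ◅ Derived⇒Star t α β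
  Derived⇒Star (node _ (letter p)) α β = step α β p ◅ ε
  Derived⇒Star (node _ (empty p))  α β = step α β p ◅ ε

  Derived⇒accepted : Derived start w → acceptedByCFG G w
  Derived⇒accepted t = subst (Star (_⇒_ G) _) (++-identityʳ _) (Derived⇒Star t [] [])

  -- One parse tree per nonterminal of a sentential form, so that a derivation can be read backwards
  -- from its terminal word.
  data Forest : List (Symbol k N) → Language k where
    []   : Forest [] []
    _∷ₜ_ : ∀ a {α} → Forest α w → Forest (terminal a ∷ α) (a ∷ w)
    _∷ₙ_ : ∀ {α} → Derived X u → Forest α v → Forest (nonterminal X ∷ α) (u ++ v)

  terminals : ∀ w → Forest (map terminal w) w
  terminals []      = []
  terminals (a ∷ w) = a ∷ₜ terminals w

  Forest-++⁻ : ∀ α {β} → Forest (α ++ β) w → ∃[ u ] ∃[ v ] (w ≡ u ++ v × Forest α u × Forest β v)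
  Forest-++⁻ []      f        = [] , _ , refl , [] , f
  Forest-++⁻ (_ ∷ α) (a ∷ₜ f) with u , v , refl , g , h ← Forest-++⁻ α f =
    a ∷ u , v , refl , a ∷ₜ g , h
  Forest-++⁻ (_ ∷ α) (_∷ₙ_ {u = t} d f) with u , v , refl , g , h ← Forest-++⁻ α f =
    t ++ u , v , sym (++-assoc t u v) , d ∷ₙ g , h

  Forest-root : Forest [ nonterminal X ] w → Derived X w
  Forest-root (d ∷ₙ []) = subst (Derived _) (sym (++-identityʳ _)) d

  graft : ∀ {γ} → QuadraticRHS γ → (X , γ) ∈ productions → Forest γ w → Derived X w
  graft (pair Y Z) p (d ∷ₙ f)   = node′ (pair p d (Forest-root f))
  graft (unit Y)   p f          = node′ (unit p (Forest-root f))
  graft (letter a) p (_ ∷ₜ [])  = node′ (letter p)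
  graft empty      p []         = node′ (empty p)

  module _ (quadratic : QuadraticNormalForm G) where

    -- The trees over `γ` become the subtrees of a new node labelled `X`.
    unstep : ∀ α {β γ} → (X , γ) ∈ productions → Forest (α ++ γ ++ β) w →
             Forest (α ++ nonterminal X ∷ β) w
    unstep [] {γ = γ} p f with _ , _ , refl , g , h ← Forest-++⁻ γ f =
      graft (All.lookup quadratic p) p g ∷ₙ h
    unstep (_ ∷ α) p (a ∷ₜ f) = a ∷ₜ unstep α p f
    unstep (_ ∷ α) p (d ∷ₙ f) = d ∷ₙ unstep α p f

    Star⇒Forest : ∀ {α β} → Star (_⇒_ G) α β → Forest β w → Forest α w
    Star⇒Forest ε                  f = f
    Star⇒Forest (step α _ p ◅ s) f = unstep α p (Star⇒Forest s f)

    CFG-ideal : ∀ {z} → acceptedByCFG G z → Ideal (treeBound N) (acceptedByCFG G) z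
    CFG-ideal {z} s = Ideal-mono ≤-refl Derived⇒accepted
      (treeIdeal N [] refl (Forest-root (Star⇒Forest s (terminals z))))

theorem14 : ∀ {k : ℕ} (L : Language k) →
    (∀ {n : ℕ} (M : NFA k n) (m : ℕ) → L ≐ acceptedByNFA M → HasDepth M m →
    PT (2 * m + 2) (↓ L) × PT (2 * m + 2) (↓< L))
    × (∀ {N : ℕ} (G : CFG k N) → L ≐ acceptedByCFG G → QuadraticNormalForm G →
    PT (4 * 3 ^ (N ∸ 1) + 2) (↓ L) × PT (4 * 3 ^ (N ∸ 1) + 2) (↓< L))
theorem14 L =
  (λ M m (L⊆ , ⊆L) depth → ideals⇒PT λ Lz →
    Ideal-mono ≤-refl ⊆L (NFA-ideal M depth (L⊆ Lz))) ,
  λ {N} G (L⊆ , ⊆L) quadratic → ideals⇒PT λ Lz →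
    Ideal-mono (treeBound≤ N) ⊆L (CFG-ideal G quadratic (L⊆ Lz))
  where
  treeBound≤ : ∀ N → treeBound N ≤ 4 * 3 ^ (N ∸ 1) + 2
  treeBound≤ zero    = z≤n
  treeBound≤ (suc n) = m≤m+n (4 * 3 ^ n) 2
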